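{- Let $n,k,t,s$ be positive integers with $1\le t<k$, $s\ge 1$ and $n\ge 4sk\binom{2k}{t+1}$. Let $\mathcal{F}\subseteq\binom{[n]}{k}$ satisfy $\nu_t(\mathcal{F})=s$. Then $|\mathcal{F}|\le \ell(n,k,t,s)$, and equality holds if $\mathcal{F}=\mathcal{S}(\mathcal{T})$ for some family $\mathcal{T}$ consisting of $s$ pairwise disjoint $t$-subsets of $[n]$.
   Context: $[n]=\{1,\dots,n\}$ and $\binom{[n]}{k}$ is the family of $k$-element subsets of $[n]$. A $t$-matching of size $m$ is a collection $\{A_1,\dots,A_m\}\subseteq\binom{[n]}{k}$ of distinct sets with $|A_i\cap A_j|<t$ for all $i\ne j$; the $t$-matching number $\nu_t(\mathcal{F})$ is the maximum size of a $t$-matching contained in $\mathcal{F}$. For $T\in\binom{[n]}{t}$, the $t$-star with center $T$ is $\mathcal{S}(T)=\{F\in\binom{[n]}{k}:T\subseteq F\}$, and for $\mathcal{T}=\{T_1,\dots,T_m\}\subseteq\binom{[n]}{t}$, $\mathcal{S}(\mathcal{T})=\bigcup_{i=1}^m\mathcal{S}(T_i)$. $\ell(n,k,t,m)$ denotes $|\mathcal{S}(\mathcal{T})|$ when $\mathcal{T}$ consists of $m$ distinct pairwise disjoint $t$-sets (this does not depend on the choice), and $\ell(n,k,t,0)=0$. -}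

module Defs where

open import Data.Bool using (Bool; true; false; _∧_; _∨_; if_then_else_)
open import Data.Nat using (ℕ; zero; suc; _+_; _*_; _≤_; _<_; _≤ᵇ_; _<ᵇ_; _≡ᵇ_)
open import Data.Fin using (Fin; toℕ)
open import Data.Vec using ([]; _∷_; tabulate)
open import Data.List using (List; []; _∷_; map; _++_; length; upTo)
open import Data.List.Relation.Unary.All using (All)
open import Data.List.Relation.Unary.Any using (Any)
open import Data.List.Relation.Unary.AllPairs using (AllPairs)
open import Data.Fin.Subset using (Subset; _⊆_; _∩_; ∣_∣; Empty)
open import Data.Fin.Subset.Properties using (_⊆?_)
open import Data.Product using (_×_; ∃)
open import Relation.Binary.PropositionalEquality using (_≡_; _≢_)
open import Relation.Nullary.Decidable using (⌊_⌋)

allSubsets : (n : ℕ) → List (Subset n)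
allSubsets zero = [] ∷ []
allSubsets (suc n) = map (true ∷_) (allSubsets n) ++ map (false ∷_) (allSubsets n)

Family : ℕ → Set
Family n = Subset n → Bool

countB : {A : Set} → (A → Bool) → List A → ℕ
countB p [] = 0
countB p (x ∷ xs) = (if p x then 1 else 0) + countB p xs

anyB : {A : Set} → (A → Bool) → List A → Bool
anyB p [] = false
anyB p (x ∷ xs) = p x ∨ anyB p xs

size : {n : ℕ} → Family n → ℕ
size {n} F = countB F (allSubsets n)

IsKUniform : {n : ℕ} → ℕ → Family n → Set
IsKUniform k F = ∀ A → F A ≡ true → ∣ A ∣ ≡ k

IsTMatching : {n : ℕ} → ℕ → Family n → List (Subset n) → Set
IsTMatching t F M =
  All (λ A → F A ≡ true) M × AllPairs (λ A B → A ≢ B × ∣ A ∩ B ∣ < t) M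

MatchingNumberIs : {n : ℕ} → ℕ → Family n → ℕ → Set
MatchingNumberIs t F s =
  ∃ (λ M → IsTMatching t F M × length M ≡ s)
  × (∀ M → IsTMatching t F M → length M ≤ s)

IsDisjointCenters : {n : ℕ} → ℕ → ℕ → List (Subset n) → Set
IsDisjointCenters t m T =
  length T ≡ m × All (λ U → ∣ U ∣ ≡ t) T
  × AllPairs (λ U V → U ≢ V × Empty (U ∩ V)) T

InStar : {n : ℕ} → ℕ → List (Subset n) → Subset n → Set
InStar k T A = ∣ A ∣ ≡ k × Any (λ U → U ⊆ A) T

block : (n t i : ℕ) → Subset n
block n t i = tabulate (λ j → (i * t ≤ᵇ toℕ j) ∧ (toℕ j <ᵇ suc i * t))

-- ℓ(n,k,t,m) = |S({block 0, …, block (m-1)})|  (meaningful when m*t ≤ n).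
ℓ : ℕ → ℕ → ℕ → ℕ → ℕ
ℓ n k t m =
  countB (λ A → (∣ A ∣ ≡ᵇ k) ∧ anyB (λ i → ⌊ block n t i ⊆? A ⌋) (upTo m))
         (allSubsets n)

{-# OPTIONS --safe #-}
module Submission where

-- Call a t-set T heavy if more than h = s·k·N(t+1) members of F contain it, where N(u) is the
-- number of k-sets containing a fixed u-set. At most h k-sets containing T share t elements
-- with one of at most s given k-sets not containing T, so deleting the star of a heavy T lowers
-- ν_t. If a member A of F contains no heavy t-set, then deleting the at most C(k,t)·h members
-- that share t elements with A lowers ν_t as well. After at most s steps F is covered by r ≤ s
-- stars and a remainder of size at most (s − r)·C(k,t)·h. Finally, the hypothesis on n gives
-- s·(k·C(k,t) + 1)·N(u+1) ≤ N(u), so r stars cover most when their centers are disjoint, and one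
-- more disjoint star adds at least C(k,t)·h.

open import Defs
open import Data.Bool using (Bool; true; false; _∧_; _∨_; if_then_else_)
open import Data.Bool.Properties using (T-≡; T-∧) renaming (_≟_ to _≟ᵇ_)
open import Data.Empty using (⊥-elim)
open import Data.Fin using (Fin; toℕ; zero; suc)
open import Data.Fin.Subset using (Subset; _⊆_; _∪_; _∩_; _─_; ∣_∣; Empty; ⊥; _∈_)
open import Data.Fin.Subset.Properties
open import Data.List using (List; []; _∷_; map; _++_; length; upTo)
open import Data.List.Membership.Propositional using (find)
open import Data.List.Properties using (length-++; length-map; length-upTo)
open import Data.List.Relation.Binary.Permutation.Propositional
  using (_↭_; ↭-refl; ↭-trans; prep; swap)
open import Data.List.Relation.Binary.Permutation.Propositional.Properties
  using (Any-resp-↭; All-resp-↭; ↭-length)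
open import Data.List.Relation.Unary.All as All using (All; []; _∷_; all?)
import Data.List.Relation.Unary.All.Properties as All
open import Data.List.Relation.Unary.AllPairs as AllPairs using (AllPairs; []; _∷_)
import Data.List.Relation.Unary.AllPairs.Properties as AllPairs
open import Data.List.Relation.Unary.Any as Any using (Any; here; there; any?)
import Data.List.Relation.Unary.Any.Properties as Any
open import Data.Nat
open import Data.Nat.Combinatorics using (_C_; nCk+nC[k+1]≡[n+1]C[k+1]; k>n⇒nCk≡0; nC1≡n)
open import Data.Nat.Properties
open import Data.Nat.Tactic.RingSolver using (solve-∀)
open import Data.Product using (_×_; _,_; proj₁; proj₂; ∃; ∃₂; uncurry)
open import Data.Sum using (_⊎_; inj₁; inj₂; [_,_]′)
open import Data.Vec using ([]; _∷_; tabulate)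
open import Data.Vec.Base using (here; there)
open import Data.Vec.Properties using (lookup∘tabulate; []=⇒lookup)
open import Function using (_∘_; id; case_of_)
open import Function.Bundles using (_⇔_; Equivalence)
open import Level using (0ℓ)
open import Relation.Binary.PropositionalEquality
open import Relation.Nullary using (¬_; Dec; yes; no; does; contradiction; ¬?; _×-dec_)
open import Relation.Nullary.Decidable using (⌊_⌋; isYes≗does)
open import Relation.Unary using (Pred; Decidable)

private variable n : ℕ

-- Binomial coefficients

-- The absorption identity. Pascal's rule splits the left side, the induction hypotheses move both
-- parts one row down, and Pascal's rule reassembles them there.
[k+1]*[n+1]C[k+1]≡[n+1]*nCk : ∀ n k → suc k * (suc n C suc k) ≡ suc n * (n C k)
[k+1]*[n+1]C[k+1]≡[n+1]*nCk zero zero = refl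
[k+1]*[n+1]C[k+1]≡[n+1]*nCk zero (suc k)
  rewrite k>n⇒nCk≡0 {1} {suc (suc k)} (s≤s (s≤s z≤n))
        | k>n⇒nCk≡0 {0} {suc k} (s≤s z≤n) = *-zeroʳ (suc (suc k))
[k+1]*[n+1]C[k+1]≡[n+1]*nCk (suc n) zero = begin
  1 * (suc (suc n) C 1)  ≡⟨ *-identityˡ _ ⟩
  suc (suc n) C 1        ≡⟨ nC1≡n (suc (suc n)) ⟩
  suc (suc n)            ≡⟨ *-identityʳ _ ⟨
  suc (suc n) * 1        ∎
  where open ≡-Reasoning
[k+1]*[n+1]C[k+1]≡[n+1]*nCk (suc n) (suc k) = begin
  suc (suc k) * (suc (suc n) C suc (suc k))
    ≡⟨ cong (suc (suc k) *_) (nCk+nC[k+1]≡[n+1]C[k+1] (suc n) (suc k)) ⟨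
  suc (suc k) * (a + b)
    ≡⟨ regroup (suc k) a b ⟩
  a + suc k * a + suc (suc k) * b
    ≡⟨ cong₂ (λ x y → a + x + y) ([k+1]*[n+1]C[k+1]≡[n+1]*nCk n k) ([k+1]*[n+1]C[k+1]≡[n+1]*nCk n (suc k)) ⟩
  a + suc n * (n C k) + suc n * (n C suc k)
    ≡⟨ +-assoc a _ _ ⟩
  a + (suc n * (n C k) + suc n * (n C suc k))
    ≡⟨ cong (a +_) (*-distribˡ-+ (suc n) (n C k) (n C suc k)) ⟨
  a + suc n * (n C k + n C suc k)
    ≡⟨ cong (λ x → a + suc n * x) (nCk+nC[k+1]≡[n+1]C[k+1] n k) ⟩
  suc (suc n) * a ∎
  where
  open ≡-Reasoning
  a = suc n C suc k
  b = suc n C suc (suc k)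
  regroup : ∀ k a b → suc k * (a + b) ≡ a + k * a + suc k * b
  regroup = solve-∀

nCk≤[j+n]Ck : ∀ j n k → n C k ≤ (j + n) C k
nCk≤[j+n]Ck zero n k = ≤-refl
nCk≤[j+n]Ck (suc j) n zero = ≤-refl
nCk≤[j+n]Ck (suc j) n (suc k) = begin
  n C suc k                        ≤⟨ nCk≤[j+n]Ck j n (suc k) ⟩
  (j + n) C suc k                  ≤⟨ m≤n+m _ _ ⟩
  (j + n) C k + (j + n) C suc k    ≡⟨ nCk+nC[k+1]≡[n+1]C[k+1] (j + n) k ⟩
  (suc j + n) C suc k              ∎
  where open ≤-Reasoning

-- Each of the `j` Pascal steps up from row `n` adds an entry that is at least `n C k`.
j*nCk≤[j+n]C[k+1] : ∀ j n k → j * (n C k) ≤ (j + n) C suc k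
j*nCk≤[j+n]C[k+1] zero n k = z≤n
j*nCk≤[j+n]C[k+1] (suc j) n k = begin
  n C k + j * (n C k)              ≤⟨ +-mono-≤ (nCk≤[j+n]Ck j n k) (j*nCk≤[j+n]C[k+1] j n k) ⟩
  (j + n) C k + (j + n) C suc k    ≡⟨ nCk+nC[k+1]≡[n+1]C[k+1] (j + n) k ⟩
  (suc j + n) C suc k              ∎
  where open ≤-Reasoning

nCk>0 : ∀ {n k} → k ≤ n → 0 < n C k
nCk>0 {n} {zero} _ = s≤s z≤n
nCk>0 {suc n} {suc k} (s≤s k≤n) =
  ≤-trans (nCk>0 k≤n) (≤-trans (m≤m+n _ _) (≤-reflexive (nCk+nC[k+1]≡[n+1]C[k+1] n k)))

-- The number of k-subsets of an n-set containing a given u-subset.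
starCard : ℕ → ℕ → ℕ → ℕ
starCard n k zero = n C k
starCard (suc n) (suc k) (suc u) = starCard n k u
starCard zero _ (suc u) = 0
starCard _ zero (suc u) = 0

starCard-Pascal₀ : ∀ n u → u ≤ n → starCard (suc n) 0 u ≡ starCard n 0 u
starCard-Pascal₀ n zero _ = refl
starCard-Pascal₀ (suc n) (suc u) _ = refl

-- Split by membership of one extra element outside the `u`-set. The condition `u ≤ n` excludes
-- degenerate values: for `n = k = 0` and `u = 1` the two sides are 0 and 1.
starCard-Pascal : ∀ n k u → u ≤ n →
  starCard n k u + starCard n (suc k) u ≡ starCard (suc n) (suc k) u
starCard-Pascal n k zero _ = nCk+nC[k+1]≡[n+1]C[k+1] n k
starCard-Pascal (suc n) zero (suc u) (s≤s u≤n) = sym (starCard-Pascal₀ n u u≤n)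
starCard-Pascal (suc n) (suc k) (suc u) (s≤s u≤n) = starCard-Pascal n k u u≤n

-- For `u < k` the ratio of the two counts is `(k - u) / (n - u)`, which is at most `k / n`. The
-- induction removes an element of the `u`-set, lowering `n`, `k` and `u` together; `1 ≤ c`
-- preserves `c * k ≤ n`. At `u = 0` the absorption identity applies.
starCard-decay : ∀ c n k u → 1 ≤ c → c * k ≤ n →
  c * starCard n k (suc u) ≤ starCard n k u
starCard-decay c zero k u 1≤c ck≤n = ≤-trans (≤-reflexive (*-zeroʳ c)) z≤n
starCard-decay c (suc n) zero u 1≤c ck≤n = ≤-trans (≤-reflexive (*-zeroʳ c)) z≤n
starCard-decay c (suc n) (suc k) zero 1≤c ck≤n = *-cancelˡ-≤ (suc k) (begin
  suc k * (c * (n C k))      ≡⟨ *-assoc (suc k) c _ ⟨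
  suc k * c * (n C k)        ≡⟨ cong (_* (n C k)) (*-comm (suc k) c) ⟩
  c * suc k * (n C k)        ≤⟨ *-monoˡ-≤ (n C k) ck≤n ⟩
  suc n * (n C k)            ≡⟨ [k+1]*[n+1]C[k+1]≡[n+1]*nCk n k ⟨
  suc k * (suc n C suc k)    ∎)
  where open ≤-Reasoning
starCard-decay c (suc n) (suc k) (suc u) 1≤c ck≤n =
  starCard-decay c n k u 1≤c (+-cancelˡ-≤ 1 _ _ (begin
    1 + c * k    ≤⟨ +-monoˡ-≤ (c * k) 1≤c ⟩
    c + c * k    ≡⟨ *-suc c k ⟨
    c * suc k    ≤⟨ ck≤n ⟩
    suc n        ∎))
  where open ≤-Reasoning

starCard-antitone : ∀ {n k u v} → k ≤ n → u ≤ v → starCard n k v ≤ starCard n k u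
starCard-antitone {n} {k} {u} k≤n u≤v = go (≤⇒≤′ u≤v)
  where
  go : ∀ {v} → u ≤′ v → starCard n k v ≤ starCard n k u
  go ≤′-refl = ≤-refl
  go (≤′-step {v} p) = ≤-trans
    (subst (_≤ starCard n k v) (*-identityˡ _)
      (starCard-decay 1 n k v ≤-refl (subst (_≤ n) (sym (*-identityˡ k)) k≤n)))
    (go p)

-- Counting

count : {A : Set} {P : Pred A 0ℓ} → Decidable P → List A → ℕ
count P? = countB (does ∘ P?)

module _ {A : Set} where

  countB-mono : {p q : A → Bool} → (∀ x → p x ≡ true → q x ≡ true) →
    ∀ xs → countB p xs ≤ countB q xs
  countB-mono p⇒q [] = z≤n
  countB-mono {p} {q} p⇒q (x ∷ xs) with p x | q x | p⇒q x
  ... | false | false | _ = countB-mono p⇒q xs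
  ... | false | true  | _ = m≤n⇒m≤1+n (countB-mono p⇒q xs)
  ... | true  | true  | _ = s≤s (countB-mono p⇒q xs)
  ... | true  | false | h = case h refl of λ ()

  does≡true : {P : Set} (P? : Dec P) → P → does P? ≡ true
  does≡true (yes _) _ = refl
  does≡true (no ¬p) p = contradiction p ¬p

  does≡true⁻ : {P : Set} (P? : Dec P) → does P? ≡ true → P
  does≡true⁻ (yes p) _ = p

  module _ {P Q : Pred A 0ℓ} (P? : Decidable P) (Q? : Decidable Q) where

    count-mono : (∀ x → P x → Q x) → ∀ xs → count P? xs ≤ count Q? xs
    count-mono P⇒Q = countB-mono (λ x → does≡true (Q? x) ∘ P⇒Q x ∘ does≡true⁻ (P? x))

    count-cong : (∀ x → P x → Q x) → (∀ x → Q x → P x) → ∀ xs → count P? xs ≡ count Q? xs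
    count-cong P⇒Q Q⇒P xs = ≤-antisym (count-mono P⇒Q xs)
      (countB-mono (λ x → does≡true (P? x) ∘ Q⇒P x ∘ does≡true⁻ (Q? x)) xs)

    count-split : ∀ xs → count P? xs ≡
      count (λ x → P? x ×-dec Q? x) xs + count (λ x → P? x ×-dec ¬? (Q? x)) xs
    count-split [] = refl
    count-split (x ∷ xs) with does (P? x) | does (Q? x)
    ... | false | _     = count-split xs
    ... | true  | true  = cong suc (count-split xs)
    ... | true  | false = trans (cong suc (count-split xs)) (sym (+-suc _ _))

    count-exists : ∀ xs → count Q? xs < count P? xs → ∃ λ x → P x × ¬ Q x
    count-exists (x ∷ xs) lt with P? x | Q? x
    ... | yes p | no ¬q = x , p , ¬q
    ... | yes _ | yes _ = count-exists xs (s≤s⁻¹ lt)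
    ... | no _  | no _  = count-exists xs lt
    ... | no _  | yes _ = count-exists xs (≤-trans (n≤1+n _) lt)

  count-zero : {P : Pred A 0ℓ} (P? : Decidable P) → (∀ x → ¬ P x) → ∀ xs → count P? xs ≡ 0
  count-zero P? ¬P [] = refl
  count-zero P? ¬P (x ∷ xs) with P? x
  ... | yes p = contradiction p (¬P x)
  ... | no _  = count-zero P? ¬P xs

  module _ {P Q R : Pred A 0ℓ} (P? : Decidable P) (Q? : Decidable Q) (R? : Decidable R) where

    count-⊎ : (∀ x → P x → Q x ⊎ R x) → ∀ xs → count P? xs ≤ count Q? xs + count R? xs
    count-⊎ cover xs = begin
      count P? xs ≡⟨ count-split P? Q? xs ⟩
      count (λ x → P? x ×-dec Q? x) xs + count (λ x → P? x ×-dec ¬? (Q? x)) xs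
        ≤⟨ +-mono-≤ (count-mono (λ x → P? x ×-dec Q? x) Q? (λ _ → proj₂) xs)
             (count-mono (λ x → P? x ×-dec ¬? (Q? x)) R? (λ x (p , ¬q) → [ (λ q → contradiction q ¬q) , id ]′ (cover x p)) xs) ⟩
      count Q? xs + count R? xs ∎
      where open ≤-Reasoning

    count-disjoint : (∀ x → P x → R x) → (∀ x → Q x → R x) → (∀ x → P x → ¬ Q x) →
      ∀ xs → count P? xs + count Q? xs ≤ count R? xs
    count-disjoint P⇒R Q⇒R P⇒¬Q xs = begin
      count P? xs + count Q? xs
        ≤⟨ +-mono-≤ (count-mono P? (λ x → R? x ×-dec P? x) (λ x p → P⇒R x p , p) xs)
             (count-mono Q? (λ x → R? x ×-dec ¬? (P? x)) (λ x q → Q⇒R x q , λ p → P⇒¬Q x p q) xs) ⟩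
      count (λ x → R? x ×-dec P? x) xs + count (λ x → R? x ×-dec ¬? (P? x)) xs
        ≡⟨ count-split R? P? xs ⟨
      count R? xs ∎
      where open ≤-Reasoning

  -- A union bound that peels off one index at a time. The bounds concern `Q i` within `P`, because
  -- a star that is not heavy is small only inside the family.
  count-Any : {I : Set} {P : Pred A 0ℓ} {Q : I → Pred A 0ℓ}
    (P? : Decidable P) (Q? : ∀ i → Decidable (Q i)) {b : ℕ} (xs : List A) (is : List I) →
    (∀ x → P x → Any (λ i → Q i x) is) →
    (All (λ i → count (λ x → P? x ×-dec Q? i x) xs ≤ b) is) →
    count P? xs ≤ length is * b
  count-Any P? Q? xs [] cover [] = ≤-reflexive (count-zero P? (λ x p → case cover x p of λ ()) xs)
  count-Any P? Q? {b} xs (i ∷ is) cover (bound ∷ bounds) = begin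
    count P? xs ≡⟨ count-split P? (Q? i) xs ⟩
    count (λ x → P? x ×-dec Q? i x) xs + count P′? xs
      ≤⟨ +-mono-≤ bound (count-Any P′? Q? xs is cover′
           (All.map (λ {j} → ≤-trans (count-mono (λ x → P′? x ×-dec Q? j x) (λ x → P? x ×-dec Q? j x)
              (λ _ ((p , _) , q) → p , q) xs)) bounds)) ⟩
    b + length is * b ∎
    where
    open ≤-Reasoning
    P′? = λ x → P? x ×-dec ¬? (Q? i x)
    cover′ : ∀ x → _ → Any _ is
    cover′ x (p , ¬q) with cover x p
    ... | here q = contradiction q ¬q
    ... | there q = q

  countB-++ : (p : A → Bool) → ∀ xs ys → countB p (xs ++ ys) ≡ countB p xs + countB p ys
  countB-++ p [] ys = refl
  countB-++ p (x ∷ xs) ys = trans (cong (_ +_) (countB-++ p xs ys)) (sym (+-assoc (if p x then 1 else 0) _ _))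

countB-map : {A B : Set} (p : B → Bool) (f : A → B) → ∀ xs → countB p (map f xs) ≡ countB (p ∘ f) xs
countB-map p f [] = refl
countB-map p f (x ∷ xs) = cong (_ +_) (countB-map p f xs)

-- Cardinalities of unions, intersections and differences

∣p∪q∣+∣p∩q∣≡∣p∣+∣q∣ : (p q : Subset n) → ∣ p ∪ q ∣ + ∣ p ∩ q ∣ ≡ ∣ p ∣ + ∣ q ∣
∣p∪q∣+∣p∩q∣≡∣p∣+∣q∣ [] [] = refl
∣p∪q∣+∣p∩q∣≡∣p∣+∣q∣ (true ∷ p) (true ∷ q) = cong suc (begin
  ∣ p ∪ q ∣ + suc ∣ p ∩ q ∣    ≡⟨ +-suc _ _ ⟩
  suc (∣ p ∪ q ∣ + ∣ p ∩ q ∣)  ≡⟨ cong suc (∣p∪q∣+∣p∩q∣≡∣p∣+∣q∣ p q) ⟩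
  suc (∣ p ∣ + ∣ q ∣)          ≡⟨ +-suc _ _ ⟨
  ∣ p ∣ + suc ∣ q ∣            ∎)
  where open ≡-Reasoning
∣p∪q∣+∣p∩q∣≡∣p∣+∣q∣ (true ∷ p) (false ∷ q) = cong suc (∣p∪q∣+∣p∩q∣≡∣p∣+∣q∣ p q)
∣p∪q∣+∣p∩q∣≡∣p∣+∣q∣ (false ∷ p) (true ∷ q) =
  trans (cong suc (∣p∪q∣+∣p∩q∣≡∣p∣+∣q∣ p q)) (sym (+-suc _ _))
∣p∪q∣+∣p∩q∣≡∣p∣+∣q∣ (false ∷ p) (false ∷ q) = ∣p∪q∣+∣p∩q∣≡∣p∣+∣q∣ p q

∣p∪q∣-disjoint : (p q : Subset n) → Empty (p ∩ q) → ∣ p ∪ q ∣ ≡ ∣ p ∣ + ∣ q ∣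
∣p∪q∣-disjoint {n} p q p∩q≡∅ = begin
  ∣ p ∪ q ∣              ≡⟨ +-identityʳ _ ⟨
  ∣ p ∪ q ∣ + 0          ≡⟨ cong (∣ p ∪ q ∣ +_) (trans (cong ∣_∣ (Empty-unique p∩q≡∅)) (∣⊥∣≡0 n)) ⟨
  ∣ p ∪ q ∣ + ∣ p ∩ q ∣  ≡⟨ ∣p∪q∣+∣p∩q∣≡∣p∣+∣q∣ p q ⟩
  ∣ p ∣ + ∣ q ∣          ∎
  where open ≡-Reasoning

x∈p⇒0<∣p∣ : ∀ {x} (p : Subset n) → x ∈ p → 0 < ∣ p ∣
x∈p⇒0<∣p∣ {x = x} p x∈p = ≤-trans (≤-reflexive (sym (∣⁅x⁆∣≡1 x)))
  (p⊆q⇒∣p∣≤∣q∣ λ y∈⁅x⁆ → subst (_∈ p) (sym (x∈⁅y⁆⇒x≡y x y∈⁅x⁆)) x∈p)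

∣p∪q∣-meeting : (p q : Subset n) → ¬ Empty (p ∩ q) → ∣ p ∪ q ∣ < ∣ p ∣ + ∣ q ∣
∣p∪q∣-meeting p q meet with nonempty? (p ∩ q)
... | no ∅ = contradiction ∅ meet
... | yes (_ , x∈) = ≤-trans (≤-reflexive (+-comm 1 _))
  (≤-trans (+-monoʳ-≤ ∣ p ∪ q ∣ (x∈p⇒0<∣p∣ (p ∩ q) x∈)) (≤-reflexive (∣p∪q∣+∣p∩q∣≡∣p∣+∣q∣ p q)))

∪-lub : ∀ {p q r : Subset n} → p ⊆ r → q ⊆ r → p ∪ q ⊆ r
∪-lub {p = p} {q} p⊆r q⊆r x∈ = [ p⊆r , q⊆r ]′ (x∈p∪q⁻ p q x∈)

-- The elements of `p ∩ q` outside `r` are counted by the first term, those inside `r` by the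
-- second. When the second term is too small, `p` must meet `q ─ r`.
∣p∩q∣≤∣[q─r]∩p∣+∣q∩r∣ : (p q r : Subset n) → ∣ p ∩ q ∣ ≤ ∣ (q ─ r) ∩ p ∣ + ∣ q ∩ r ∣
∣p∩q∣≤∣[q─r]∩p∣+∣q∩r∣ [] [] [] = z≤n
∣p∩q∣≤∣[q─r]∩p∣+∣q∩r∣ (true ∷ p) (true ∷ q) (true ∷ r) =
  ≤-trans (s≤s (∣p∩q∣≤∣[q─r]∩p∣+∣q∩r∣ p q r)) (≤-reflexive (sym (+-suc _ _)))
∣p∩q∣≤∣[q─r]∩p∣+∣q∩r∣ (true ∷ p) (true ∷ q) (false ∷ r) = s≤s (∣p∩q∣≤∣[q─r]∩p∣+∣q∩r∣ p q r)
∣p∩q∣≤∣[q─r]∩p∣+∣q∩r∣ (true ∷ p) (false ∷ q) (true ∷ r) = ∣p∩q∣≤∣[q─r]∩p∣+∣q∩r∣ p q r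
∣p∩q∣≤∣[q─r]∩p∣+∣q∩r∣ (true ∷ p) (false ∷ q) (false ∷ r) = ∣p∩q∣≤∣[q─r]∩p∣+∣q∩r∣ p q r
∣p∩q∣≤∣[q─r]∩p∣+∣q∩r∣ (false ∷ p) (true ∷ q) (true ∷ r) =
  ≤-trans (m≤n⇒m≤1+n (∣p∩q∣≤∣[q─r]∩p∣+∣q∩r∣ p q r)) (≤-reflexive (sym (+-suc _ _)))
∣p∩q∣≤∣[q─r]∩p∣+∣q∩r∣ (false ∷ p) (true ∷ q) (false ∷ r) = ∣p∩q∣≤∣[q─r]∩p∣+∣q∩r∣ p q r
∣p∩q∣≤∣[q─r]∩p∣+∣q∩r∣ (false ∷ p) (false ∷ q) (true ∷ r) = ∣p∩q∣≤∣[q─r]∩p∣+∣q∩r∣ p q r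
∣p∩q∣≤∣[q─r]∩p∣+∣q∩r∣ (false ∷ p) (false ∷ q) (false ∷ r) = ∣p∩q∣≤∣[q─r]∩p∣+∣q∩r∣ p q r

x∈p─q⇒x∉q : ∀ {x} (p q : Subset n) → x ∈ p ─ q → ¬ x ∈ q
x∈p─q⇒x∉q (true ∷ p) (true ∷ q) () here
x∈p─q⇒x∉q (_ ∷ p) (_ ∷ q) (there x∈) (there x∈q) = x∈p─q⇒x∉q p q x∈ x∈q

∣q∩p∣<∣p∣ : (p q : Subset n) → ¬ p ⊆ q → ∣ q ∩ p ∣ < ∣ p ∣
∣q∩p∣<∣p∣ p q p⊈q with ∣ q ∩ p ∣ <? ∣ p ∣
... | yes lt = lt
... | no ≮ = ⊥-elim (p⊈q p⊆q)
  where
  p⊆q : p ⊆ q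
  p⊆q {x} x∈p with x ∈? q
  ... | yes x∈q = x∈q
  ... | no x∉q = contradiction
    (p⊂q⇒∣p∣<∣q∣ (p∩q⊆q q p , x , x∈p , x∉q ∘ proj₁ ∘ x∈p∩q⁻ q p)) ≮

-- Subsets of prescribed size

-- An explicit list, so that it can be the index list of `count-Any`, where its length becomes the
-- factor in the bound.
choose : ℕ → Subset n → List (Subset n)
choose zero A = ⊥ ∷ []
choose (suc t) [] = []
choose (suc t) (true ∷ A) = map (true ∷_) (choose t A) ++ map (false ∷_) (choose (suc t) A)
choose (suc t) (false ∷ A) = map (false ∷_) (choose (suc t) A)

length-choose : ∀ t (A : Subset n) → length (choose t A) ≡ ∣ A ∣ C t
length-choose zero A = refl
length-choose (suc t) [] = sym (k>n⇒nCk≡0 {0} {suc t} (s≤s z≤n))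
length-choose (suc t) (true ∷ A) = begin
  length (map (true ∷_) (choose t A) ++ map (false ∷_) (choose (suc t) A))
    ≡⟨ length-++ (map (true ∷_) (choose t A)) ⟩
  length (map (true ∷_) (choose t A)) + length (map (false ∷_) (choose (suc t) A))
    ≡⟨ cong₂ _+_ (trans (length-map _ (choose t A)) (length-choose t A))
         (trans (length-map _ (choose (suc t) A)) (length-choose (suc t) A)) ⟩
  ∣ A ∣ C t + ∣ A ∣ C suc t
    ≡⟨ nCk+nC[k+1]≡[n+1]C[k+1] ∣ A ∣ t ⟩
  suc ∣ A ∣ C suc t ∎
  where open ≡-Reasoning
length-choose (suc t) (false ∷ A) = trans (length-map _ (choose (suc t) A)) (length-choose (suc t) A)

choose-sound : ∀ t (A : Subset n) → All (λ T → ∣ T ∣ ≡ t × T ⊆ A) (choose t A)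
choose-sound {n} zero A = (∣⊥∣≡0 n , ⊥⊆) ∷ []
choose-sound (suc t) [] = []
choose-sound (suc t) (true ∷ A) = All.++⁺
  (All.map⁺ {f = true ∷_} (All.map (λ (size≡ , T⊆A) → cong suc size≡ , λ {_} → s⊆s T⊆A) (choose-sound t A)))
  (All.map⁺ {f = false ∷_} (All.map (λ (size≡ , T⊆A) → size≡ , λ {_} → out⊆ T⊆A) (choose-sound (suc t) A)))
choose-sound (suc t) (false ∷ A) =
  All.map⁺ {f = false ∷_} (All.map (λ (size≡ , T⊆A) → size≡ , λ {_} → out⊆ T⊆A) (choose-sound (suc t) A))

-- Turns a large intersection with `A` into membership in one of finitely many stars. An element of
-- `A` outside `B` is skipped, which costs nothing in `A ∩ B`.
choose-complete : ∀ t (A B : Subset n) → t ≤ ∣ A ∩ B ∣ → Any (_⊆ B) (choose t A)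
choose-complete zero A B _ = here ⊥⊆
choose-complete (suc t) [] [] ()
choose-complete (suc t) (true ∷ A) (true ∷ B) (s≤s t≤) =
  Any.++⁺ˡ (Any.map⁺ {f = true ∷_} (Any.map (λ {T} (T⊆B : T ⊆ B) {_} → s⊆s T⊆B) (choose-complete t A B t≤)))
choose-complete (suc t) (true ∷ A) (false ∷ B) t≤ =
  Any.++⁺ʳ (map (true ∷_) (choose t A)) (Any.map⁺ {f = false ∷_} (Any.map (λ {T} (T⊆B : T ⊆ B) {_} → out⊆ T⊆B) (choose-complete (suc t) A B t≤)))
choose-complete (suc t) (false ∷ A) (_ ∷ B) t≤ =
  Any.map⁺ {f = false ∷_} (Any.map (λ {T} (T⊆B : T ⊆ B) {_} → out⊆ T⊆B) (choose-complete (suc t) A B t≤))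

-- Stars

card : {P : Pred (Subset n) 0ℓ} → Decidable P → ℕ
card {n} P? = count P? (allSubsets n)

Star : ℕ → Subset n → Pred (Subset n) 0ℓ
Star k U A = ∣ A ∣ ≡ k × U ⊆ A

star? : ∀ k (U : Subset n) → Decidable (Star k U)
star? k U A = (∣ A ∣ ≟ k) ×-dec (U ⊆? A)

-- Induction along the ground set: `allSubsets` lists the sets with the first element, then those
-- without it. If that element is in `U` only the first half counts; otherwise `starCard-Pascal`
-- adds the halves.
card-star : ∀ k (U : Subset n) → card (star? k U) ≡ starCard n k ∣ U ∣
card-star zero [] = refl
card-star (suc k) [] = sym (k>n⇒nCk≡0 {0} {suc k} (s≤s z≤n))
card-star {suc n} k (b ∷ U) = trans
  (countB-++ _ (map (true ∷_) (allSubsets n)) (map (false ∷_) (allSubsets n)))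
  (trans (cong₂ _+_ (countB-map _ (true ∷_) (allSubsets n)) (countB-map _ (false ∷_) (allSubsets n)))
    (halves k b))
  where
  with? : ∀ k b → Decidable (Star k (b ∷ U) ∘ (true ∷_))
  with? k b A = star? k (b ∷ U) (true ∷ A)
  without? : ∀ k b → Decidable (Star k (b ∷ U) ∘ (false ∷_))
  without? k b A = star? k (b ∷ U) (false ∷ A)

  with≡0 : ∀ b → card (with? 0 b) ≡ 0
  with≡0 b = count-zero (with? 0 b) (λ _ ()) (allSubsets n)
  with≡ : ∀ k b → card (with? (suc k) b) ≡ starCard n k ∣ U ∣
  with≡ k true = trans (count-cong (with? (suc k) true) (star? k U)
    (λ _ (e , U⊆A) → suc-injective e , drop-∷-⊆ U⊆A)
    (λ _ (e , U⊆A) → cong suc e , s⊆s U⊆A) (allSubsets n)) (card-star k U)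
  with≡ k false = trans (count-cong (with? (suc k) false) (star? k U)
    (λ _ (e , U⊆A) → suc-injective e , drop-∷-⊆ U⊆A)
    (λ _ (e , U⊆A) → cong suc e , out⊆ U⊆A) (allSubsets n)) (card-star k U)
  without≡0 : ∀ k → card (without? k true) ≡ 0
  without≡0 k = count-zero (without? k true) (λ _ (_ , U⊆A) → case U⊆A here of λ ()) (allSubsets n)
  without≡ : ∀ k → card (without? k false) ≡ starCard n k ∣ U ∣
  without≡ k = trans (count-cong (without? k false) (star? k U)
    (λ _ (e , U⊆A) → e , drop-∷-⊆ U⊆A)
    (λ _ (e , U⊆A) → e , out⊆ U⊆A) (allSubsets n)) (card-star k U)

  halves : ∀ k b → card (with? k b) + card (without? k b) ≡ starCard (suc n) k ∣ b ∷ U ∣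
  halves zero true = cong₂ _+_ (with≡0 true) (without≡0 0)
  halves (suc k) true = trans (cong₂ _+_ (with≡ k true) (without≡0 (suc k))) (+-identityʳ _)
  halves zero false = trans (cong₂ _+_ (with≡0 false) (without≡ 0)) (sym (starCard-Pascal₀ n ∣ U ∣ (∣p∣≤n U)))
  halves (suc k) false = trans (cong₂ _+_ (with≡ k false) (without≡ (suc k)))
    (starCard-Pascal n k ∣ U ∣ (∣p∣≤n U))

Hits : List (Subset n) → Pred (Subset n) 0ℓ
Hits Ts A = Any (_⊆ A) Ts

hits? : (Ts : List (Subset n)) → Decidable (Hits Ts)
hits? Ts A = any? (_⊆? A) Ts

inStar? : ∀ k (Ts : List (Subset n)) → Decidable (InStar k Ts)
inStar? k Ts A = (∣ A ∣ ≟ k) ×-dec hits? Ts A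

Avoiding : ℕ → Subset n → List (Subset n) → Pred (Subset n) 0ℓ
Avoiding k U Ts A = Star k U A × ¬ Hits Ts A

avoiding? : ∀ k (U : Subset n) Ts → Decidable (Avoiding k U Ts)
avoiding? k U Ts A = star? k U A ×-dec ¬? (hits? Ts A)

card-inStar-∷ : ∀ k (T : Subset n) Ts →
  card (inStar? k (T ∷ Ts)) ≡ card (inStar? k Ts) + card (avoiding? k T Ts)
card-inStar-∷ {n} k T Ts = trans (count-split (inStar? k (T ∷ Ts)) (hits? Ts) (allSubsets n)) (cong₂ _+_
  (count-cong (λ A → inStar? k (T ∷ Ts) A ×-dec hits? Ts A) (inStar? k Ts)
    (λ _ ((e , _) , hit) → e , hit) (λ _ (e , hit) → (e , there hit) , hit) (allSubsets n))
  (count-cong (λ A → inStar? k (T ∷ Ts) A ×-dec ¬? (hits? Ts A)) (avoiding? k T Ts)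
    (λ { _ ((e , here T⊆A) , ¬hit) → (e , λ {_} → T⊆A) , ¬hit
       ; _ ((e , there hit) , ¬hit) → contradiction hit ¬hit })
    (λ _ ((e , T⊆A) , ¬hit) → (e , here (λ {_} → T⊆A)) , ¬hit) (allSubsets n)))

-- Split by whether `T ⊆ A`. Containing both `U` and `T` means containing `U ∪ T`, so both parts are
-- again counts of the same kind; this is the recursion behind `avoidingCard`.
card-avoiding-∷ : ∀ k (U T : Subset n) Ts →
  card (avoiding? k U Ts) ≡ card (avoiding? k (U ∪ T) Ts) + card (avoiding? k U (T ∷ Ts))
card-avoiding-∷ {n} k U T Ts = trans (count-split (avoiding? k U Ts) (T ⊆?_) (allSubsets n)) (cong₂ _+_
  (count-cong (λ A → avoiding? k U Ts A ×-dec T ⊆? A) (avoiding? k (U ∪ T) Ts)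
    (λ _ (((e , U⊆A) , ¬hit) , T⊆A) → (e , λ {_} → ∪-lub U⊆A T⊆A) , ¬hit)
    (λ _ ((e , U∪T⊆A) , ¬hit) →
      ((e , λ {_} → U∪T⊆A ∘ p⊆p∪q T) , ¬hit) , λ {_} → U∪T⊆A ∘ q⊆p∪q U T) (allSubsets n))
  (count-cong (λ A → avoiding? k U Ts A ×-dec ¬? (T ⊆? A)) (avoiding? k U (T ∷ Ts))
    (λ { _ ((star , ¬hit) , T⊈A) → star , λ { (here T⊆A) → T⊈A T⊆A ; (there hit) → ¬hit hit } })
    (λ _ (star , ¬hit) → (star , ¬hit ∘ there) , λ T⊆A → ¬hit (here (λ {_} → T⊆A))) (allSubsets n)))

-- Unions of stars with disjoint or meeting centers

Disjoint : Subset n → Subset n → Set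
Disjoint U V = Empty (U ∩ V)

disjoint? : (U V : Subset n) → Dec (Disjoint U V)
disjoint? U V = ¬? (nonempty? (U ∩ V))

∪-Disjoint : ∀ {U T V : Subset n} → Disjoint U V → Disjoint T V → Disjoint (U ∪ T) V
∪-Disjoint {U = U} {T} {V} U⊥V T⊥V (x , x∈) with x∈p∩q⁻ (U ∪ T) V x∈
... | x∈U∪T , x∈V with x∈p∪q⁻ U T x∈U∪T
... | inj₁ x∈U = U⊥V (x , x∈p∩q⁺ (x∈U , x∈V))
... | inj₂ x∈T = T⊥V (x , x∈p∩q⁺ (x∈T , x∈V))

-- The center that meets another one is moved to the front, where `card-inStar-∷` can split off its
-- star.
pairwiseDisjoint⊎meeting : (Ts : List (Subset n)) → AllPairs Disjoint Ts ⊎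
  ∃₂ λ T Us → Ts ↭ T ∷ Us × Any (λ V → ¬ Disjoint T V) Us
pairwiseDisjoint⊎meeting [] = inj₁ []
pairwiseDisjoint⊎meeting (T ∷ Ts) with all? (disjoint? T) Ts
... | no ¬all = inj₂ (T , Ts , ↭-refl , All.¬All⇒Any¬ (disjoint? T) Ts ¬all)
... | yes all with pairwiseDisjoint⊎meeting Ts
...   | inj₁ disj = inj₁ (all ∷ disj)
...   | inj₂ (V , Us , perm , meet) =
  inj₂ (V , T ∷ Us , ↭-trans (prep T perm) (swap T V ↭-refl) , there meet)

module _ (n k t : ℕ) where

  -- The number of k-subsets of an n-set that contain a u-set U and none of r t-sets, where
  -- U and the t-sets are pairwise disjoint.
  avoidingCard : ℕ → ℕ → ℕ
  avoidingCard u zero = starCard n k u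
  avoidingCard u (suc r) = avoidingCard u r ∸ avoidingCard (u + t) r

  -- The size of a union of `r` stars with pairwise disjoint `t`-element centers, built star by
  -- star: a new star adds only the sets that contain no earlier center.
  unionCard : ℕ → ℕ
  unionCard zero = 0
  unionCard (suc r) = unionCard r + avoidingCard t r

  avoidingCard≤starCard : ∀ u r → avoidingCard u r ≤ starCard n k u
  avoidingCard≤starCard u zero = ≤-refl
  avoidingCard≤starCard u (suc r) = ≤-trans (m∸n≤m (avoidingCard u r) (avoidingCard (u + t) r)) (avoidingCard≤starCard u r)

  -- A Bonferroni bound: each of the `r` forbidden `t`-sets removes at most `starCard n k (u + t)`
  -- sets.
  starCard≤avoidingCard+ : ∀ u r → starCard n k u ≤ avoidingCard u r + r * starCard n k (u + t)
  starCard≤avoidingCard+ u zero = m≤m+n _ _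
  starCard≤avoidingCard+ u (suc r) = begin
    starCard n k u                        ≤⟨ starCard≤avoidingCard+ u r ⟩
    -- Valid for truncated subtraction as well, so no comparison of the two counts is needed.
    avoidingCard u r + r * N              ≤⟨ +-monoˡ-≤ (r * N) (m≤n+m∸n _ (avoidingCard (u + t) r)) ⟩
    avoidingCard (u + t) r + avoidingCard u (suc r) + r * N
      ≤⟨ +-monoˡ-≤ (r * N) (+-monoˡ-≤ _ (avoidingCard≤starCard (u + t) r)) ⟩
    N + avoidingCard u (suc r) + r * N    ≡⟨ regroup N _ _ ⟩
    avoidingCard u (suc r) + (N + r * N)  ∎
    where
    open ≤-Reasoning
    N = starCard n k (u + t)
    regroup : ∀ a b c → a + b + c ≡ b + (a + c)
    regroup = solve-∀

  -- Solve `card-avoiding-∷` for its last term. The subtraction is exact, since a part is taken from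
  -- its whole, and `U ∪ T` is disjoint from the remaining centers, so induction covers both counts.
  card-avoiding : ∀ (U : Subset n) Ts → All (λ T → ∣ T ∣ ≡ t) Ts → AllPairs Disjoint (U ∷ Ts) →
    card (avoiding? k U Ts) ≡ avoidingCard ∣ U ∣ (length Ts)
  card-avoiding U [] _ _ = trans
    (count-cong (avoiding? k U []) (star? k U) (λ _ → proj₁) (λ _ star → star , λ ()) (allSubsets n))
    (card-star k U)
  card-avoiding U (T ∷ Ts) (∣T∣≡t ∷ sizes) ((U⊥T ∷ U⊥Ts) ∷ T⊥Ts ∷ disj) = begin
    card (avoiding? k U (T ∷ Ts))
      ≡⟨ m+n∸m≡n (card (avoiding? k (U ∪ T) Ts)) _ ⟨
    card (avoiding? k (U ∪ T) Ts) + card (avoiding? k U (T ∷ Ts)) ∸ card (avoiding? k (U ∪ T) Ts)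
      ≡⟨ cong (_∸ card (avoiding? k (U ∪ T) Ts)) (card-avoiding-∷ k U T Ts) ⟨
    card (avoiding? k U Ts) ∸ card (avoiding? k (U ∪ T) Ts)
      ≡⟨ cong₂ _∸_ (card-avoiding U Ts sizes (U⊥Ts ∷ disj))
           (card-avoiding (U ∪ T) Ts sizes
             (All.zipWith (uncurry ∪-Disjoint) (U⊥Ts , T⊥Ts) ∷ disj)) ⟩
    (avoidingCard ∣ U ∣ r) ∸ (avoidingCard ∣ U ∪ T ∣ r)
      ≡⟨ cong (λ u → (avoidingCard ∣ U ∣ r) ∸ avoidingCard u r)
           (trans (∣p∪q∣-disjoint U T U⊥T) (cong (∣ U ∣ +_) ∣T∣≡t)) ⟩
    avoidingCard ∣ U ∣ (suc r) ∎
    where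
    open ≡-Reasoning
    r = length Ts

  card-inStar-disjoint : ∀ Ts → All (λ T → ∣ T ∣ ≡ t) Ts → AllPairs Disjoint Ts →
    card (inStar? k Ts) ≡ unionCard (length Ts)
  card-inStar-disjoint [] _ _ = count-zero (inStar? k []) (λ _ ()) (allSubsets n)
  card-inStar-disjoint (T ∷ Ts) (∣T∣≡t ∷ sizes) (T⊥Ts ∷ disj) = trans (card-inStar-∷ k T Ts)
    (cong₂ _+_ (card-inStar-disjoint Ts sizes disj)
      (trans (card-avoiding T Ts sizes (T⊥Ts ∷ disj)) (cong (λ u → avoidingCard u (length Ts)) ∣T∣≡t)))

  -- If `T` meets a center `V`, its star loses all sets containing `T ∪ V`, which has fewer than
  -- `t + t` elements. In the disjoint case the loss is at most `s * starCard n k (t + t)`, which by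
  -- decay is no larger. Adding the first loss to both sides avoids subtraction.
  card-avoiding-meeting : ∀ (T : Subset n) Ts s → 1 ≤ s → k ≤ n → s * k ≤ n → length Ts ≤ s →
    ∣ T ∣ ≡ t → All (λ V → ∣ V ∣ ≡ t) Ts → Any (λ V → ¬ Disjoint T V) Ts →
    card (avoiding? k T Ts) ≤ avoidingCard t (length Ts)
  card-avoiding-meeting T Ts s 1≤s k≤n sk≤n r≤s ∣T∣≡t sizes meet =
    +-cancelʳ-≤ (starCard n k ∣ T ∪ V ∣) _ _ (begin
      card (avoiding? k T Ts) + starCard n k ∣ T ∪ V ∣
        ≡⟨ cong (card (avoiding? k T Ts) +_) (card-star k (T ∪ V)) ⟨
      card (avoiding? k T Ts) + card (star? k (T ∪ V))
        ≤⟨ count-disjoint (avoiding? k T Ts) (star? k (T ∪ V)) (star? k T)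
             (λ _ → proj₁) (λ _ (e , T∪V⊆A) → e , λ {_} → T∪V⊆A ∘ p⊆p∪q V)
             (λ A (_ , ¬hit) (_ , T∪V⊆A) → ¬hit (Any.map
               (λ {W} V≡W {_} → subst (_⊆ A) V≡W (λ {_} → T∪V⊆A ∘ q⊆p∪q T V)) V∈Ts))
             (allSubsets n) ⟩
      card (star? k T)
        ≡⟨ trans (card-star k T) (cong (starCard n k) ∣T∣≡t) ⟩
      starCard n k t
        ≤⟨ starCard≤avoidingCard+ t r ⟩
      avoidingCard t r + r * starCard n k (t + t)
        ≤⟨ +-monoʳ-≤ (avoidingCard t r) (*-mono-≤ r≤s (starCard-antitone k≤n v<t+t)) ⟩
      avoidingCard t r + s * starCard n k (suc ∣ T ∪ V ∣)
        ≤⟨ +-monoʳ-≤ (avoidingCard t r) (starCard-decay s n k _ 1≤s sk≤n) ⟩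
      avoidingCard t r + starCard n k ∣ T ∪ V ∣ ∎)
    where
    open ≤-Reasoning
    r = length Ts
    V = Any.lookup meet
    V∈Ts : Any (V ≡_) Ts
    V∈Ts = lookup∈ meet
      where
      lookup∈ : ∀ {P : Pred (Subset n) 0ℓ} {Vs} (p : Any P Vs) → Any (Any.lookup p ≡_) Vs
      lookup∈ (here _) = here refl
      lookup∈ (there p) = there (lookup∈ p)
    v<t+t : ∣ T ∪ V ∣ < t + t
    v<t+t = subst (∣ T ∪ V ∣ <_)
      (cong₂ _+_ ∣T∣≡t (All.lookupWith (λ ∣W∣≡t V≡W → trans (cong ∣_∣ V≡W) ∣W∣≡t) sizes V∈Ts))
      (∣p∪q∣-meeting T V (Any.lookup-result meet))

  -- Disjoint centers give equality. Otherwise a center meeting another is split off: it adds at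
  -- most `avoidingCard t r`, and induction handles the rest. The recursion is on the length `r`,
  -- because `Us` comes from a permutation of `Ts`.
  card-inStar≤unionCard : ∀ s → 1 ≤ s → k ≤ n → s * k ≤ n →
    ∀ r (Ts : List (Subset n)) → length Ts ≡ r → r ≤ s → All (λ T → ∣ T ∣ ≡ t) Ts →
    card (inStar? k Ts) ≤ unionCard r
  card-inStar≤unionCard s 1≤s k≤n sk≤n zero [] _ _ sizes =
    ≤-reflexive (card-inStar-disjoint [] sizes [])
  card-inStar≤unionCard s 1≤s k≤n sk≤n (suc r) Ts len r<s sizes with pairwiseDisjoint⊎meeting Ts
  ... | inj₁ disj = ≤-reflexive (trans (card-inStar-disjoint Ts sizes disj) (cong unionCard len))
  ... | inj₂ (T , Us , perm , meet) with All-resp-↭ perm sizes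
  ...   | ∣T∣≡t ∷ sizes′ = begin
    card (inStar? k Ts)
      ≤⟨ count-mono (inStar? k Ts) (inStar? k (T ∷ Us))
           (λ _ (e , hit) → e , Any-resp-↭ perm hit) (allSubsets n) ⟩
    card (inStar? k (T ∷ Us))
      ≡⟨ card-inStar-∷ k T Us ⟩
    card (inStar? k Us) + card (avoiding? k T Us)
      ≤⟨ +-mono-≤ (card-inStar≤unionCard s 1≤s k≤n sk≤n r Us len′ (≤-trans (n≤1+n r) r<s) sizes′)
           (≤-trans (card-avoiding-meeting T Us s 1≤s k≤n sk≤n
             (≤-trans (≤-reflexive len′) (≤-trans (n≤1+n r) r<s)) ∣T∣≡t sizes′ meet)
             (≤-reflexive (cong (avoidingCard t) len′))) ⟩
    unionCard (suc r) ∎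
    where
    open ≤-Reasoning
    len′ : length Us ≡ r
    len′ = suc-injective (trans (sym (↭-length perm)) len)

-- Blocks

-- The left side computes to `a <ᵇ suc j`; only a case split on `a` makes the two sides agree.
suc≤ᵇsuc : ∀ a j → (suc a ≤ᵇ suc j) ≡ (a ≤ᵇ j)
suc≤ᵇsuc zero j = refl
suc≤ᵇsuc (suc a) j = refl

-- Stated for any `f` with these values, so that the induction can pass to `f ∘ suc` and shift the
-- interval down by one.
∣tabulate∣-interval : ∀ n a b → b ≤ n → (f : Fin n → Bool) →
  (∀ j → f j ≡ ((a ≤ᵇ toℕ j) ∧ (toℕ j <ᵇ b))) → ∣ tabulate f ∣ ≡ b ∸ a
∣tabulate∣-interval zero a zero _ f f≡ = sym (0∸n≡0 a)
∣tabulate∣-interval (suc n) a b b≤n f f≡ with f zero | f≡ zero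
∣tabulate∣-interval (suc n) zero zero b≤n f f≡ | _ | refl =
  ∣tabulate∣-interval n zero zero z≤n (f ∘ suc) (f≡ ∘ suc)
∣tabulate∣-interval (suc n) zero (suc b) (s≤s b≤n) f f≡ | _ | refl =
  cong suc (∣tabulate∣-interval n zero b b≤n (f ∘ suc) (f≡ ∘ suc))
∣tabulate∣-interval (suc n) (suc a) zero b≤n f f≡ | _ | refl =
  trans (∣tabulate∣-interval n a zero z≤n (f ∘ suc) λ j → trans (f≡ (suc j)) (cong (_∧ false) (suc≤ᵇsuc a (toℕ j))))
    (0∸n≡0 a)
∣tabulate∣-interval (suc n) (suc a) (suc b) (s≤s b≤n) f f≡ | _ | refl =
  ∣tabulate∣-interval n a b b≤n (f ∘ suc) λ j → trans (f≡ (suc j)) (cong (_∧ (toℕ j <ᵇ b)) (suc≤ᵇsuc a (toℕ j)))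

∣block∣ : ∀ n t i → suc i * t ≤ n → ∣ block n t i ∣ ≡ t
∣block∣ n t i le = trans (∣tabulate∣-interval n (i * t) (suc i * t) le _ (λ _ → refl)) (m+n∸n≡m t (i * t))

∈block⁻ : ∀ n t i {x} → x ∈ block n t i → i * t ≤ toℕ x × toℕ x < suc i * t
∈block⁻ n t i {x} x∈ with Equivalence.to T-∧
  (Equivalence.from T-≡ (trans (sym (lookup∘tabulate _ x)) ([]=⇒lookup x∈)))
... | lo , hi = ≤ᵇ⇒≤ (i * t) (toℕ x) lo , <ᵇ⇒< (toℕ x) (suc i * t) hi

block-disjoint : ∀ n t {i j} → i < j → Disjoint (block n t i) (block n t j)
block-disjoint n t {i} {j} i<j (x , x∈) with x∈p∩q⁻ (block n t i) (block n t j) x∈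
... | x∈i , x∈j = <-irrefl refl (begin-strict
  toℕ x        <⟨ proj₂ (∈block⁻ n t i x∈i) ⟩
  suc i * t    ≤⟨ *-monoˡ-≤ t i<j ⟩
  j * t        ≤⟨ proj₁ (∈block⁻ n t j x∈j) ⟩
  toℕ x        ∎)
  where open ≤-Reasoning

blocks : (n t m : ℕ) → List (Subset n)
blocks n t m = map (block n t) (upTo m)

anyB≡does : ∀ {I : Set} (f : I → Subset n) A is →
  anyB (λ i → ⌊ f i ⊆? A ⌋) is ≡ does (hits? (map f is) A)
anyB≡does f A [] = refl
anyB≡does f A (i ∷ is) = cong₂ _∨_ (isYes≗does (f i ⊆? A)) (anyB≡does f A is)

countB-cong : {A : Set} {p q : A → Bool} → (∀ x → p x ≡ q x) → ∀ xs → countB p xs ≡ countB q xs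
countB-cong p≗q [] = refl
countB-cong p≗q (x ∷ xs) = cong₂ (λ b c → (if b then 1 else 0) + c) (p≗q x) (countB-cong p≗q xs)

-- The condition `m * t ≤ n` ensures that no block is cut off by the end of the ground set, so the
-- blocks are disjoint centers of size exactly `t`.
ℓ≡unionCard : ∀ n k t m → m * t ≤ n → ℓ n k t m ≡ unionCard n k t m
ℓ≡unionCard n k t m mt≤n = begin
  ℓ n k t m
    -- `does (∣ A ∣ ≟ k)` reduces to `∣ A ∣ ≡ᵇ k`, so only the second conjunct has to be rewritten.
    ≡⟨ countB-cong (λ A → cong ((∣ A ∣ ≡ᵇ k) ∧_) (anyB≡does (block n t) A (upTo m))) (allSubsets n) ⟩
  card (inStar? k (blocks n t m))
    ≡⟨ card-inStar-disjoint n k t (blocks n t m)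
         (All.map⁺ (All.applyUpTo⁺₁ id m λ {i} i<m → ∣block∣ n t i (≤-trans (*-monoˡ-≤ t i<m) mt≤n)))
         (AllPairs.map⁺ (AllPairs.applyUpTo⁺₁ id m λ i<j _ → block-disjoint n t i<j)) ⟩
  unionCard n k t (length (blocks n t m))
    ≡⟨ cong (unionCard n k t) (trans (length-map (block n t) (upTo m)) (length-upTo m)) ⟩
  unionCard n k t m ∎
  where open ≡-Reasoning

-- Lowering the matching number by deletions

-- Every such A contains T together with an element of B ─ T.
card-star-meeting : ∀ k (T B : Subset n) → ¬ T ⊆ B →
  card (λ A → star? k T A ×-dec (∣ T ∣ ≤? ∣ A ∩ B ∣)) ≤ ∣ B ∣ * starCard n k (suc ∣ T ∣)
card-star-meeting {n} k T B T⊈B = begin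
  card near?
    ≤⟨ count-Any near? (λ X A → X ⊆? A) (allSubsets n) (choose 1 (B ─ T)) cover
         (All.map (λ {X} → bound X) (choose-sound 1 (B ─ T))) ⟩
  length (choose 1 (B ─ T)) * N
    ≡⟨ cong (_* N) (trans (length-choose 1 (B ─ T)) (nC1≡n ∣ B ─ T ∣)) ⟩
  ∣ B ─ T ∣ * N
    ≤⟨ *-monoˡ-≤ N (∣p─q∣≤∣p∣ B T) ⟩
  ∣ B ∣ * N ∎
  where
  open ≤-Reasoning
  N = starCard n k (suc ∣ T ∣)
  near? = λ A → star? k T A ×-dec (∣ T ∣ ≤? ∣ A ∩ B ∣)

  cover : ∀ A → Star k T A × ∣ T ∣ ≤ ∣ A ∩ B ∣ → Any (_⊆ A) (choose 1 (B ─ T))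
  -- Fewer than `∣ T ∣` elements of `B` lie in `T`, because `T` is not inside `B`; hence some common
  -- element of `A` and `B` lies in `B ─ T`.
  cover A (_ , t≤) = choose-complete 1 (B ─ T) A (+-cancelʳ-< ∣ B ∩ T ∣ 0 _ (begin-strict
    ∣ B ∩ T ∣                        <⟨ ∣q∩p∣<∣p∣ T B T⊈B ⟩
    ∣ T ∣                            ≤⟨ t≤ ⟩
    ∣ A ∩ B ∣                        ≤⟨ ∣p∩q∣≤∣[q─r]∩p∣+∣q∩r∣ A B T ⟩
    ∣ (B ─ T) ∩ A ∣ + ∣ B ∩ T ∣      ∎))

  bound : ∀ X → ∣ X ∣ ≡ 1 × X ⊆ B ─ T → card (λ A → near? A ×-dec (X ⊆? A)) ≤ N
  bound X (∣X∣≡1 , X⊆B─T) = begin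
    card (λ A → near? A ×-dec (X ⊆? A))
      ≤⟨ count-mono (λ A → near? A ×-dec (X ⊆? A)) (star? k (T ∪ X))
           (λ _ (((e , T⊆A) , _) , X⊆A) → e , λ {_} → ∪-lub T⊆A X⊆A) (allSubsets n) ⟩
    card (star? k (T ∪ X))
      ≡⟨ card-star k (T ∪ X) ⟩
    starCard n k ∣ T ∪ X ∣
      ≡⟨ cong (starCard n k) (trans (∣p∪q∣-disjoint T X T⊥X)
           (trans (cong (∣ T ∣ +_) ∣X∣≡1) (+-comm ∣ T ∣ 1))) ⟩
    N ∎
    where
    T⊥X : Disjoint T X
    T⊥X (x , x∈) with x∈p∩q⁻ T X x∈
    ... | x∈T , x∈X = x∈p─q⇒x∉q B T (X⊆B─T x∈X) x∈T

-- `IsTMatching` for an arbitrary predicate, so that the induction can pass to subfamilies.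
Matching : ℕ → Pred (Subset n) 0ℓ → List (Subset n) → Set
Matching t P M = All P M × AllPairs (λ A B → A ≢ B × ∣ A ∩ B ∣ < t) M

module _ (n k t s : ℕ) (t<k : t < k) where

  heavy : ℕ
  heavy = s * (k * starCard n k (suc t))

  -- Distinctness follows from the small intersections: `A ≡ B` would give `∣ A ∩ B ∣ ≡ k`, which
  -- exceeds `t`.
  extend : ∀ {P : Pred (Subset n) 0ℓ} {A M} → P A → ∣ A ∣ ≡ k →
    All (λ B → ∣ A ∩ B ∣ < t) M → Matching t P M → Matching t P (A ∷ M)
  extend {A = A} pA ∣A∣≡k far (M⊆P , pairs) = pA ∷ M⊆P ,
    All.map (λ lt → (λ { refl → <-asym t<k (subst (_< t) (trans (cong ∣_∣ (∩-idem A)) ∣A∣≡k) lt) }) , lt) far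
    ∷ pairs

  module _ {P : Pred (Subset n) 0ℓ} (P? : Decidable P) (uniform : ∀ {A} → P A → ∣ A ∣ ≡ k) where

    -- No member of `M` contains `T`, so by `card-star-meeting` at most `heavy` sets of the star are
    -- near some member of `M`. A heavy star thus has a member of the family that is far from all of
    -- `M`.
    matching-delete-heavy : ∀ T → ∣ T ∣ ≡ t → heavy < card (λ A → P? A ×-dec (T ⊆? A)) →
      ∀ M → length M ≤ s → Matching t (λ A → P A × ¬ T ⊆ A) M → ∃ λ A → Matching t P (A ∷ M)
    matching-delete-heavy T refl T-heavy M ∣M∣≤s (M⊆P′ , pairs)
      with count-exists (λ A → P? A ×-dec (T ⊆? A)) near? (allSubsets n) (≤-trans (s≤s near≤heavy) T-heavy)
      where
      near? = λ A → star? k T A ×-dec any? (λ B → ∣ T ∣ ≤? ∣ A ∩ B ∣) M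
      near≤heavy : card near? ≤ heavy
      near≤heavy = ≤-trans
        (count-Any near? (λ B A → ∣ T ∣ ≤? ∣ A ∩ B ∣) (allSubsets n) M (λ _ → proj₂)
          (All.map (λ {B} (pB , T⊈B) → ≤-trans
            (count-mono (λ A → near? A ×-dec (∣ T ∣ ≤? ∣ A ∩ B ∣)) (λ A → star? k T A ×-dec (∣ T ∣ ≤? ∣ A ∩ B ∣))
              (λ _ ((star , _) , t≤) → star , t≤) (allSubsets n))
            (≤-trans (card-star-meeting k T B T⊈B) (*-monoˡ-≤ _ (≤-reflexive (uniform pB))))) M⊆P′))
        (*-monoˡ-≤ _ ∣M∣≤s)
    ... | A , (pA , T⊆A) , ¬near = A , extend pA (uniform pA)
      (All.map ≰⇒> (All.¬Any⇒All¬ M (λ any → ¬near ((uniform pA , λ {_} → T⊆A) , any))))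
      (All.map proj₁ M⊆P′ , pairs)

  -- Induction on the bound `m` for the matching number. Each round spends one unit: deleting a
  -- heavy star adds a center, deleting the sets near a member raises `d`. The threshold keeps the
  -- original `s` throughout, so all deletions of the second kind share one cost bound.
  remove-stars : ∀ m → m ≤ s → {P : Pred (Subset n) 0ℓ} (P? : Decidable P) → (∀ {A} → P A → ∣ A ∣ ≡ k) →
    (∀ M → Matching t P M → length M ≤ m) →
    ∃ λ Ts → All (λ T → ∣ T ∣ ≡ t) Ts × ∃ λ d → d + length Ts ≡ m ×
      card (λ A → P? A ×-dec ¬? (hits? Ts A)) ≤ d * ((k C t) * heavy)
  remove-stars m m≤s {P} P? uniform ν≤m with anySubset? P?
  -- An empty family stops early; all unspent units go to `d`, so the total is still `m`.
  ... | no ¬∃ = [] , [] , m , +-identityʳ m ,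
    ≤-trans (≤-reflexive (count-zero (λ A → P? A ×-dec ¬? (hits? [] A)) (λ A (p , _) → ¬∃ (A , p)) (allSubsets n))) z≤n
  remove-stars zero m≤s P? uniform ν≤m | yes (A , pA) =
    case ν≤m (A ∷ []) (extend pA (uniform pA) [] ([] , [])) of λ ()
  remove-stars (suc m) m<s {P} P? uniform ν≤1+m | yes (A , pA)
    with any? (λ T → heavy <? card (λ B → P? B ×-dec (T ⊆? B))) (choose t A)
  ... | yes ∃heavy with find ∃heavy
  ...   | T , T∈ , T-heavy =
    let Ts , sizes , d , d+r≡m , bound = remove-stars m (≤-trans (n≤1+n m) m<s)
          (λ B → P? B ×-dec ¬? (T ⊆? B)) (uniform ∘ proj₁)
          -- `ν≤1+m` is used twice: on `M`, for the length bound `s` that the extension requires,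
          -- and on the extended matching, which yields `length M ≤ m`.
          (λ M matching → s≤s⁻¹ (let _ , matching⁺ = matching-delete-heavy P? uniform T ∣T∣≡t T-heavy M
                                       (≤-trans (ν≤1+m M (All.map proj₁ (proj₁ matching) , proj₂ matching)) m<s)
                                       matching
                                 in ν≤1+m _ matching⁺))
    in T ∷ Ts , ∣T∣≡t ∷ sizes , d , trans (+-suc d _) (cong suc d+r≡m) ,
       ≤-trans (count-mono (λ B → P? B ×-dec ¬? (hits? (T ∷ Ts) B))
                 (λ B → (P? B ×-dec ¬? (T ⊆? B)) ×-dec ¬? (hits? Ts B))
                 (λ _ (p , ¬hit) → (p , λ T⊆B → ¬hit (here (λ {_} → T⊆B))) , ¬hit ∘ there) (allSubsets n)) bound
    where
    ∣T∣≡t : ∣ T ∣ ≡ t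
    ∣T∣≡t = proj₁ (All.lookup (choose-sound t A) T∈)
  -- No `t`-subset of `A` is heavy. Every matching of sets far from `A` extends by `A`, so passing
  -- to `far?` lowers the bound.
  remove-stars (suc m) m<s {P} P? uniform ν≤1+m | yes (A , pA) | no ¬∃heavy =
    let Ts , sizes , d , d+r≡m , bound = remove-stars m (≤-trans (n≤1+n m) m<s) far? (uniform ∘ proj₁)
          (λ M (M⊆far , pairs) → s≤s⁻¹ (ν≤1+m (A ∷ M)
            (extend pA (uniform pA) (All.map proj₂ M⊆far) (All.map proj₁ M⊆far , pairs))))
    in Ts , sizes , suc d , cong suc d+r≡m , (begin
      card (λ B → P? B ×-dec ¬? (hits? Ts B))
        ≤⟨ count-⊎ (λ B → P? B ×-dec ¬? (hits? Ts B)) near? (λ B → far? B ×-dec ¬? (hits? Ts B))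
             (λ B (p , ¬hit) → case ∣ A ∩ B ∣ <? t of λ where
               (yes lt) → inj₂ ((p , lt) , ¬hit)
               (no ≮t) → inj₁ (p , choose-complete t A B (≮⇒≥ ≮t)))
             (allSubsets n) ⟩
      card near? + card (λ B → far? B ×-dec ¬? (hits? Ts B))
        ≤⟨ +-mono-≤ near≤ bound ⟩
      suc d * ((k C t) * heavy) ∎)
    where
    open ≤-Reasoning
    far? = λ B → P? B ×-dec (∣ A ∩ B ∣ <? t)
    near? = λ B → P? B ×-dec hits? (choose t A) B
    near≤ : card near? ≤ (k C t) * heavy
    near≤ = subst (λ c → card near? ≤ c * heavy) (trans (length-choose t A) (cong (_C t) (uniform pA)))
      (count-Any near? (λ T B → T ⊆? B) (allSubsets n) (choose t A) (λ _ → proj₂)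
        (All.map (λ {T} ≯ → ≤-trans
            (count-mono (λ B → near? B ×-dec (T ⊆? B)) (λ B → P? B ×-dec (T ⊆? B))
              (λ _ ((p , _) , T⊆B) → p , λ {_} → T⊆B) (allSubsets n))
            (≮⇒≥ ≯))
          (All.¬Any⇒All¬ (choose t A) ¬∃heavy)))

-- Estimates for large ground sets

module _ {n k t s : ℕ} (1≤t : 1 ≤ t) (t<k : t < k) (1≤s : 1 ≤ s) (large : s * suc (k * (k C t)) * k ≤ n) where

  private
    sk≤n : s * k ≤ n
    sk≤n = ≤-trans (*-monoˡ-≤ k (m≤m*n s (suc (k * (k C t))))) large

    k≤n : k ≤ n
    k≤n = ≤-trans (m≤n*m k s ⦃ >-nonZero 1≤s ⦄) sk≤n

    loss : ℕ
    loss = (k C t) * heavy n k t s t<k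

  -- By the Bonferroni bound a further disjoint star gains at least `starCard n k t` minus
  -- `r * starCard n k (t + t)`. Since `t + 1 ≤ t + t`, the subtracted term is at most `s * N`, and
  -- `loss + s * N` is the multiple of `N` that `starCard-decay` bounds by `starCard n k t`.
  loss≤avoidingCard : ∀ {r} → r < s → loss ≤ avoidingCard n k t t r
  loss≤avoidingCard {r} r<s = +-cancelʳ-≤ (r * starCard n k (t + t)) _ _ (begin
    loss + r * starCard n k (t + t)
      ≤⟨ +-monoʳ-≤ loss (*-mono-≤ (<⇒≤ r<s) (starCard-antitone k≤n (+-monoˡ-≤ t 1≤t))) ⟩
    loss + s * N
      ≡⟨ factor (k C t) s k N ⟩
    s * suc (k * (k C t)) * N
      ≤⟨ starCard-decay (s * suc (k * (k C t))) n k t (*-mono-≤ 1≤s (s≤s z≤n)) large ⟩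
    starCard n k t
      ≤⟨ starCard≤avoidingCard+ n k t t r ⟩
    avoidingCard n k t t r + r * starCard n k (t + t) ∎)
    where
    open ≤-Reasoning
    N = starCard n k (suc t)
    factor : ∀ c s k N → c * (s * (k * N)) + s * N ≡ s * suc (k * c) * N
    factor = solve-∀

  -- Trades each of `d` deletions near a member for one more disjoint star.
  unionCard-gap : ∀ d r → d + r ≤ s → unionCard n k t r + d * loss ≤ unionCard n k t (d + r)
  unionCard-gap zero r _ = ≤-reflexive (+-identityʳ _)
  unionCard-gap (suc d) r d+r<s = begin
    unionCard n k t r + (loss + d * loss)
      ≡⟨ regroup (unionCard n k t r) loss (d * loss) ⟩
    unionCard n k t r + d * loss + loss
      ≤⟨ +-mono-≤ (unionCard-gap d r (<⇒≤ d+r<s)) (loss≤avoidingCard d+r<s) ⟩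
    unionCard n k t (suc d + r) ∎
    where
    open ≤-Reasoning
    regroup : ∀ a b c → a + (b + c) ≡ a + c + b
    regroup = solve-∀

  card≤unionCard : {P : Pred (Subset n) 0ℓ} (P? : Decidable P) → (∀ {A} → P A → ∣ A ∣ ≡ k) →
    (∀ M → Matching t P M → length M ≤ s) → card P? ≤ unionCard n k t s
  card≤unionCard P? uniform ν≤s =
    let Ts , sizes , d , d+r≡s , bound = remove-stars n k t s t<k s ≤-refl P? uniform ν≤s
        r≤s = subst (length Ts ≤_) d+r≡s (m≤n+m (length Ts) d)
    in begin
      card P?
        ≤⟨ count-⊎ P? (inStar? k Ts) (λ A → P? A ×-dec ¬? (hits? Ts A))
             (λ A p → case hits? Ts A of λ where
               (yes hit) → inj₁ (uniform p , hit)
               (no ¬hit) → inj₂ (p , ¬hit))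
             (allSubsets n) ⟩
      card (inStar? k Ts) + card (λ A → P? A ×-dec ¬? (hits? Ts A))
        ≤⟨ +-mono-≤ (card-inStar≤unionCard n k t s 1≤s k≤n sk≤n (length Ts) Ts refl r≤s sizes) bound ⟩
      unionCard n k t (length Ts) + d * loss
        ≤⟨ unionCard-gap d (length Ts) (≤-reflexive d+r≡s) ⟩
      unionCard n k t (d + length Ts)
        ≡⟨ cong (unionCard n k t) d+r≡s ⟩
      unionCard n k t s ∎
    where open ≤-Reasoning

-- Since `1 ≤ k * c ≤ B`, the factor `suc (k * c)` is at most `B + B`.
large-enough : ∀ n k t s → t < k → 4 * s * k * ((2 * k) C (t + 1)) ≤ n →
  s * suc (k * (k C t)) * k ≤ n
large-enough n k t s t<k le = begin
  s * suc (k * c) * k         ≤⟨ *-monoˡ-≤ k (*-monoʳ-≤ s (+-mono-≤ (≤-trans 0<kc kc≤B) kc≤B)) ⟩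
  s * (B + B) * k             ≤⟨ *-monoˡ-≤ k (*-monoʳ-≤ s (m≤m+n (B + B) (B + B))) ⟩
  s * (B + B + (B + B)) * k   ≡⟨ regroup s k B ⟩
  4 * s * k * B               ≤⟨ le ⟩
  n                           ∎
  where
  open ≤-Reasoning
  c = k C t
  B = (2 * k) C (t + 1)
  0<kc : 0 < k * c
  0<kc = *-mono-≤ (≤-trans (s≤s z≤n) t<k) (nCk>0 (<⇒≤ t<k))
  kc≤B : k * c ≤ B
  -- Both `j` and the row are `k`; `2 * k` unfolds to `k + (k + 0)`.
  kc≤B = ≤-trans (j*nCk≤[j+n]C[k+1] k k t)
    (≤-reflexive (cong₂ _C_ (cong (k +_) (sym (+-identityʳ k))) (+-comm 1 t)))
  regroup : ∀ s k B → s * (B + B + (B + B)) * k ≡ 4 * s * k * B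
  regroup = solve-∀

-- The bound and the equality case for Boolean families

size≡card : (F : Family n) → size F ≡ card (λ A → F A ≟ᵇ true)
size≡card F = countB-cong (λ A → lem (F A)) (allSubsets _)
  where
  lem : ∀ b → b ≡ does (b ≟ᵇ true)
  lem true = refl
  lem false = refl

theorem1p2 : (n k t s : ℕ) → 1 ≤ t → t < k → 1 ≤ s
    → 4 * s * k * ((2 * k) C (t + 1)) ≤ n
    → (F : Family n) → IsKUniform k F → MatchingNumberIs t F s
    → size F ≤ ℓ n k t s
      × ((T : List (Subset n)) → IsDisjointCenters t s T
         → (∀ A → (F A ≡ true) ⇔ InStar k T A)
         → size F ≡ ℓ n k t s)
theorem1p2 n k t s 1≤t t<k 1≤s le F uniform (_ , ν≤s) = upper , equality
  where
  large : s * suc (k * (k C t)) * k ≤ n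
  large = large-enough n k t s t<k le

  ℓ≡ : ℓ n k t s ≡ unionCard n k t s
  -- Room for the `s` blocks: `s * t ≤ s * k ≤ n`.
  ℓ≡ = ℓ≡unionCard n k t s (≤-trans (*-monoʳ-≤ s (<⇒≤ t<k))
    (≤-trans (*-monoˡ-≤ k (m≤m*n s (suc (k * (k C t))))) large))

  upper : size F ≤ ℓ n k t s
  upper = subst₂ _≤_ (sym (size≡card F)) (sym ℓ≡)
    (card≤unionCard 1≤t t<k 1≤s large (λ A → F A ≟ᵇ true) (uniform _) ν≤s)

  equality : (T : List (Subset n)) → IsDisjointCenters t s T
    → (∀ A → (F A ≡ true) ⇔ InStar k T A) → size F ≡ ℓ n k t s
  equality T (∣T∣≡s , sizes , disj) F⇔ = begin
    size F
      ≡⟨ size≡card F ⟩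
    card (λ A → F A ≟ᵇ true)
      ≡⟨ count-cong (λ A → F A ≟ᵇ true) (inStar? k T)
           (λ A → Equivalence.to (F⇔ A)) (λ A → Equivalence.from (F⇔ A)) (allSubsets n) ⟩
    card (inStar? k T)
      -- The count depends only on the number of disjoint centers, so `T` gives the same value as
      -- the blocks in `ℓ`.
      ≡⟨ card-inStar-disjoint n k t T sizes (AllPairs.map proj₂ disj) ⟩
    unionCard n k t (length T)
      ≡⟨ cong (unionCard n k t) ∣T∣≡s ⟩
    unionCard n k t s
      ≡⟨ ℓ≡ ⟨
    ℓ n k t s ∎
    where open ≡-Reasoning
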